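{- There exist finite connected simple graphs $H_1$ and $H_2$ having a common universal cover (equivalently, a common finite connected covering graph) such that their minimal common cover is not unique. That is, there exist at least two pairwise non-isomorphic connected graphs, each of which is a covering graph of both $H_1$ and $H_2$, and each of which has the minimum number of vertices among all connected common covering graphs of $H_1$ and $H_2$.
   Context: A graph $\tilde G$ is a covering graph of a graph $G$ if there is a surjective graph homomorphism $f\colon\tilde G\to G$ such that, for every vertex $v$ of $\tilde G$, $f$ maps the set of edges incident with $v$ bijectively onto the set of edges incident with $f(v)$. A common cover of $H_1$ and $H_2$ is a graph that is a covering graph of both. The universal cover of a connected graph is its (possibly infinite) universal covering tree. -}

module Defs where

open import Data.Fin using (Fin; zero; suc; inject₁; fromℕ)
open import Data.Nat using (ℕ; _+_; _≤_)
open import Data.Product using (Σ; ∃; ∃-syntax; _×_; _,_)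
open import Data.Sum using (_⊎_; inj₁; inj₂)
open import Function.Base using (_on_)
open import Function.Bundles using (_↔_; _⇔_; Inverse)
open import Function.Definitions using (Injective; Surjective; Bijective)
open import Level using (0ℓ)
open import Relation.Binary.Construct.Closure.ReflexiveTransitive using (Star)
open import Relation.Binary.Core using (Rel)
open import Relation.Binary.Definitions using (Symmetric; Irreflexive)
open import Relation.Binary.PropositionalEquality using (_≡_; cong)
open import Relation.Nullary using (¬_)

-- Simple, possibly infinite, graphs.  Covering graphs of simple graphs are
-- again simple: a loop would map to a loop, and two parallel edges to two
-- distinct parallel edges.
record SimpleGraph : Set₁ where
  infix 4 _~_
  field
    Vertex : Set
    _~_    : Rel Vertex 0ℓ
    ~-sym    : Symmetric _~_
    ~-irrefl : Irreflexive _≡_ _~_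

open SimpleGraph public using (Vertex)

Adj : (G : SimpleGraph) → Rel (Vertex G) 0ℓ
Adj = SimpleGraph._~_

HasOrder : SimpleGraph → ℕ → Set
HasOrder G n = Vertex G ↔ Fin n

Finite : SimpleGraph → Set
Finite G = ∃[ n ] HasOrder G n

Connected : SimpleGraph → Set
Connected G = Vertex G × (∀ u v → Star (Adj G) u v)

-- An edge is stored with an arbitrary choice of orientation; `SameEdge`
-- forgets both the orientation and the adjacency proof.
record Edge (G : SimpleGraph) : Set where
  constructor edge
  field
    end₁ end₂ : Vertex G
    adjacent  : Adj G end₁ end₂

open Edge public

SameEdge : (G : SimpleGraph) → Rel (Edge G) 0ℓ
SameEdge G e e′ = (end₁ e ≡ end₁ e′ × end₂ e ≡ end₂ e′)
                ⊎ (end₁ e ≡ end₂ e′ × end₂ e ≡ end₁ e′)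

Incident : (G : SimpleGraph) → Vertex G → Edge G → Set
Incident G v e = v ≡ end₁ e ⊎ v ≡ end₂ e

EdgeAt : (G : SimpleGraph) → Vertex G → Set
EdgeAt G v = Σ (Edge G) (Incident G v)

SameEdgeAt : (G : SimpleGraph) (v : Vertex G) → Rel (EdgeAt G v) 0ℓ
SameEdgeAt G v = SameEdge G on Σ.proj₁

IsHom : (G H : SimpleGraph) → (Vertex G → Vertex H) → Set
IsHom G H f = ∀ {u v} → Adj G u v → Adj H (f u) (f v)

module _ {G H : SimpleGraph} (f : Vertex G → Vertex H) (hom : IsHom G H f) where

  mapEdge : Edge G → Edge H
  mapEdge (edge u v a) = edge (f u) (f v) (hom a)

  mapEdgeAt : ∀ v → EdgeAt G v → EdgeAt H (f v)
  mapEdgeAt v (e , inj₁ p) = mapEdge e , inj₁ (cong f p)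
  mapEdgeAt v (e , inj₂ p) = mapEdge e , inj₂ (cong f p)

record IsCovering (G H : SimpleGraph) (f : Vertex G → Vertex H) : Set where
  field
    hom        : IsHom G H f
    surjective : Surjective _≡_ _≡_ f
    bijective  : ∀ v → Bijective (SameEdgeAt G v) (SameEdgeAt H (f v))
                         (mapEdgeAt {G} {H} f hom v)

_Covers_ : SimpleGraph → SimpleGraph → Set
G Covers H = ∃ (IsCovering G H)

CommonCover : (H₁ H₂ K : SimpleGraph) → Set
CommonCover H₁ H₂ K = K Covers H₁ × K Covers H₂

record Cycle (G : SimpleGraph) : Set where
  field
    {k}      : ℕ
    vertexAt : Fin (3 + k) → Vertex G
    distinct : Injective _≡_ _≡_ vertexAt
    step     : ∀ (i : Fin (2 + k)) → Adj G (vertexAt (inject₁ i)) (vertexAt (suc i))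
    close    : Adj G (vertexAt (fromℕ (2 + k))) (vertexAt zero)

IsTree : SimpleGraph → Set
IsTree G = Connected G × ¬ Cycle G

-- The universal cover of a connected graph is, up to isomorphism, its
-- unique covering graph that is a tree.
IsUniversalCover : (H T : SimpleGraph) → Set
IsUniversalCover H T = IsTree T × T Covers H

HaveCommonUniversalCover : (H₁ H₂ : SimpleGraph) → Set₁
HaveCommonUniversalCover H₁ H₂ =
  ∃[ T ] (IsUniversalCover H₁ T × IsUniversalCover H₂ T)

-- Competitors of finite order suffice: an infinite graph always has more
-- vertices than the finite graph K.
IsMinimalCommonCover : (H₁ H₂ K : SimpleGraph) → Set₁
IsMinimalCommonCover H₁ H₂ K =
  Connected K × CommonCover H₁ H₂ K ×
  ∃[ n ] (HasOrder K n ×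
    (∀ (L : SimpleGraph) (m : ℕ) →
       Connected L → CommonCover H₁ H₂ L → HasOrder L m → n ≤ m))

Isomorphic : SimpleGraph → SimpleGraph → Set
Isomorphic G H =
  Σ (Vertex G ↔ Vertex H) λ φ →
    ∀ u v → Adj G u v ⇔ Adj H (Inverse.to φ u) (Inverse.to φ v)

{-# OPTIONS --safe #-}
-- Every graph here is cubic, so the 3-regular tree is a common universal cover.
-- H₁ has 8 vertices and H₂ is K₄.  Five vertices of H₁ are pairwise at distance
-- at most 2, and a covering map separates such vertices, so H₁ does not cover K₄.
-- If one fibre of a covering map L → H₁ is a singleton then, by connectedness,
-- all fibres are, so that L ≅ H₁; hence for a common cover L all fibres over H₁
-- have at least two elements and L has at least 16 vertices.  Two double covers
-- of H₁ also cover K₄; the two triangles of H₁ lift to one, but not to the other.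
module Submission where

open import Data.Bool using (Bool; true; false; if_then_else_)
import Data.Bool.Properties as Bool
open import Data.Empty using (⊥; ⊥-elim; ⊥-elim-irr)
open import Data.Fin using (Fin; suc; inject₁; fromℕ; opposite; remQuot; _<_)
open import Data.Fin.Patterns
open import Data.Fin.Properties
  using ( _≟_; all?; any?; pigeonhole; injective⇒≤; inj⇒≟; suc-injective; *↔×; <⇒≢
        ; opposite-involutive)
open import Data.List using (List; []; _∷_; foldr; length)
open import Data.List.Membership.Propositional using (_∈_)
open import Data.List.Properties using (∷-injectiveˡ; ∷-injectiveʳ)
open import Data.List.Relation.Unary.Any using (here; there)
import Data.List.Relation.Unary.Any as Any
open import Data.List.Relation.Unary.Linked using (Linked; []; [-]; _∷_)
import Data.List.Relation.Unary.Linked as Linked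
open import Data.Nat as ℕ using (ℕ; zero; suc; _*_; _≤_)
import Data.Nat.Properties as ℕ
open import Data.Product using (∃-syntax; _×_; _,_; proj₁; proj₂)
open import Data.Product.Properties using (≡-dec; ×-≡,≡→≡)
open import Data.Sum using (_⊎_; inj₁; inj₂)
open import Data.Vec using (Vec; []; _∷_; lookup)
open import Function using (_∘_; _↔_; Inverse; Injection; Equivalence; Injective)
open import Function.Construct.Identity using (↔-id)
open import Function.Construct.Symmetry using (↔-sym)
open import Function.Properties.Inverse using (↔⇒↣)
open import Relation.Binary.Construct.Closure.ReflexiveTransitive
  using (Star; ε; _◅_; _◅◅_; reverse)
open import Relation.Binary.Definitions using (DecidableEquality)
open import Relation.Binary.PropositionalEquality
  using (_≡_; _≢_; refl; sym; trans; cong; cong₂; subst; subst₂)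
open import Relation.Nullary using (¬_; Dec; yes; no; contradiction)
open import Relation.Nullary.Decidable
  using (from-yes; ¬?; _×-dec_; _→-dec_; _⊎-dec_; decidable-stable)
open import Defs

-- Covering maps as local bijections on neighbourhoods

-- In a simple graph an edge at `u` is determined by its other end, so edges up to `SameEdge` can be
-- traded for neighbours.
record LocallyBijective (G H : SimpleGraph) (f : Vertex G → Vertex H) : Set where
  field
    hom       : IsHom G H f
    separates : ∀ {u v w} → Adj G u v → Adj G u w → f v ≡ f w → v ≡ w
    lifts     : ∀ {u y} → Adj H (f u) y → ∃[ v ] (Adj G u v × f v ≡ y)

module _ {G H : SimpleGraph} {f : Vertex G → Vertex H} where
  private
    module G = SimpleGraph G
    module H = SimpleGraph H

  -- Walk lifting that keeps only the end point. It yields surjectivity onto a connected graph.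
  lift-walk : LocallyBijective G H f → ∀ {x u v} → f u ≡ x →
              Star (Adj H) x v → ∃[ u′ ] f u′ ≡ v
  lift-walk lb eq   ε       = _ , eq
  lift-walk lb refl (a ◅ s) with w , _ , fw≡y ← LocallyBijective.lifts lb a =
    lift-walk lb fw≡y s

  locallyBijective⇒covering : LocallyBijective G H f → Vertex G → Connected H →
                              IsCovering G H f
  locallyBijective⇒covering lb u₀ (_ , walk) = record
    { hom        = hom
    ; surjective = λ y → let u , fu≡y = lift-walk lb refl (walk (f u₀) y)
                         in u , λ { refl → fu≡y }
    ; bijective  = λ v → (λ {d} {e} → inj v d e) , surj v
    }
    where
    open LocallyBijective lb

    -- Either the far ends of the two edges have the same image, and `separates` applies, or `f v`
    -- equals the image of a neighbour of `v`, a loop in `H`.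
    inj : ∀ v (d e : EdgeAt G v) →
          SameEdgeAt H (f v) (mapEdgeAt {G} {H} f hom v d) (mapEdgeAt {G} {H} f hom v e) →
          SameEdgeAt G v d e
    inj v (edge _ _ a , inj₁ refl) (edge _ _ b , inj₁ refl) (inj₁ (_ , q)) =
      inj₁ (refl , separates a b q)
    inj v (edge _ _ a , inj₁ refl) (edge _ _ b , inj₁ refl) (inj₂ (p , _)) =
      ⊥-elim (H.~-irrefl p (hom b))
    inj v (edge _ _ a , inj₁ refl) (edge _ _ b , inj₂ refl) (inj₁ (p , _)) =
      ⊥-elim (H.~-irrefl (sym p) (hom b))
    inj v (edge _ _ a , inj₁ refl) (edge _ _ b , inj₂ refl) (inj₂ (_ , q)) =
      inj₂ (refl , separates a (G.~-sym b) q)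
    inj v (edge _ _ a , inj₂ refl) (edge _ _ b , inj₁ refl) (inj₁ (_ , q)) =
      ⊥-elim (H.~-irrefl q (hom b))
    inj v (edge _ _ a , inj₂ refl) (edge _ _ b , inj₁ refl) (inj₂ (p , _)) =
      inj₂ (separates (G.~-sym a) b p , refl)
    inj v (edge _ _ a , inj₂ refl) (edge _ _ b , inj₂ refl) (inj₁ (p , _)) =
      inj₁ (separates (G.~-sym a) (G.~-sym b) p , refl)
    inj v (edge _ _ a , inj₂ refl) (edge _ _ b , inj₂ refl) (inj₂ (_ , q)) =
      ⊥-elim (H.~-irrefl (sym q) (hom b))

    surj : ∀ v (e : EdgeAt H (f v)) → ∃[ d ]
           (∀ {d′} → SameEdgeAt G v d′ d →
            SameEdgeAt H (f v) (mapEdgeAt {G} {H} f hom v d′) e)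
    surj v (edge _ y a , inj₁ refl) with lifts a
    ... | w , b , refl = (edge v w b , inj₁ refl) , λ
      { {edge _ _ _ , inj₁ _} (inj₁ (refl , refl)) → inj₁ (refl , refl)
      ; {edge _ _ _ , inj₁ _} (inj₂ (refl , refl)) → inj₂ (refl , refl)
      ; {edge _ _ _ , inj₂ _} (inj₁ (refl , refl)) → inj₁ (refl , refl)
      ; {edge _ _ _ , inj₂ _} (inj₂ (refl , refl)) → inj₂ (refl , refl)
      }
    surj v (edge y _ a , inj₂ refl) with lifts (H.~-sym a)
    ... | w , b , refl = (edge v w b , inj₁ refl) , λ
      { {edge _ _ _ , inj₁ _} (inj₁ (refl , refl)) → inj₂ (refl , refl)
      ; {edge _ _ _ , inj₁ _} (inj₂ (refl , refl)) → inj₁ (refl , refl)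
      ; {edge _ _ _ , inj₂ _} (inj₁ (refl , refl)) → inj₂ (refl , refl)
      ; {edge _ _ _ , inj₂ _} (inj₂ (refl , refl)) → inj₁ (refl , refl)
      }

  covering⇒locallyBijective : IsCovering G H f → LocallyBijective G H f
  covering⇒locallyBijective cov = record
    { hom = hom ; separates = separates ; lifts = lifts }
    where
    open IsCovering cov

    separates : ∀ {u v w} → Adj G u v → Adj G u w → f v ≡ f w → v ≡ w
    separates {u} a b eq with proj₁ (bijective u)
                                {edge _ _ a , inj₁ refl} {edge _ _ b , inj₁ refl}
                                (inj₁ (refl , eq))
    ... | inj₁ (_ , q)    = q
    ... | inj₂ (refl , q) = q

    lifts : ∀ {u y} → Adj H (f u) y → ∃[ v ] (Adj G u v × f v ≡ y)
    lifts {u} {y} a with proj₂ (bijective u) (edge (f u) y a , inj₁ refl)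
    ... | (edge _ w b , inj₁ refl) , same with same {edge _ w b , inj₁ refl} (inj₁ (refl , refl))
    ...   | inj₁ (_ , q) = w , b , q
    ...   | inj₂ (p , _) = ⊥-elim (H.~-irrefl p a)
    lifts {u} {y} a | (edge w _ b , inj₂ refl) , same
      with same {edge w _ b , inj₂ refl} (inj₁ (refl , refl))
    ...   | inj₁ (_ , q) = ⊥-elim (H.~-irrefl q a)
    ...   | inj₂ (p , _) = w , G.~-sym b , p

-- Lower bound on the order of a cover

module _ {L H : SimpleGraph} {f : Vertex L → Vertex H} (lb : LocallyBijective L H f) where
  open LocallyBijective lb

  SubsingletonFibre : Vertex H → Set
  SubsingletonFibre v = ∀ x y → f x ≡ v → f y ≡ v → x ≡ y

  -- Points `x` and `y` over `w` have neighbours over `v`. These coincide by hypothesis, and local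
  -- injectivity at the common neighbour gives `x ≡ y`.
  subsingleton-step : ∀ {v w} → Adj H v w → SubsingletonFibre v → SubsingletonFibre w
  subsingleton-step {v} a sub x y refl fy≡w
    with x′ , x~x′ , fx′≡v ← lifts (SimpleGraph.~-sym H a)
       | y′ , y~y′ , fy′≡v ← lifts (subst (λ z → Adj H z v) (sym fy≡w) (SimpleGraph.~-sym H a))
    with refl ← sub x′ y′ fx′≡v fy′≡v =
    separates (SimpleGraph.~-sym L x~x′) (SimpleGraph.~-sym L y~y′) (sym fy≡w)

  subsingleton-walk : ∀ {v w} → Star (Adj H) v w → SubsingletonFibre v → SubsingletonFibre w
  subsingleton-walk ε       sub = sub
  subsingleton-walk (a ◅ s) sub = subsingleton-walk s (subsingleton-step a sub)

↔⇒≟ : ∀ {A : Set} {n} → A ↔ Fin n → DecidableEquality A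
↔⇒≟ = inj⇒≟ ∘ ↔⇒↣

Inverse-injective : ∀ {A B : Set} (φ : A ↔ B) → Injective _≡_ _≡_ (Inverse.to φ)
Inverse-injective = Injection.injective ∘ ↔⇒↣

-- A fibre without a second point would spread along walks to all fibres and make `f` injective. Two
-- points chosen in every fibre embed `Fin n × Fin 2` into `L`.
noninjective-covering-order :
  ∀ {L H : SimpleGraph} {f : Vertex L → Vertex H} {m n} →
  IsCovering L H f → Connected H → HasOrder L m → HasOrder H n →
  ¬ Injective _≡_ _≡_ f → n * 2 ≤ m
noninjective-covering-order {L} {H} {f} {m} {n} cov (_ , walk) L↔ H↔ ¬inj =
  injective⇒≤ {f = λ k → let i , s = remQuot {n} 2 k in to L↔ (point s (from H↔ i))}
    (λ {k} {l} eq →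
      let p , q = point-injective _ _ (Inverse-injective L↔ eq)
      in Inverse-injective (*↔× {n} {2}) (×-≡,≡→≡ (Inverse-injective (↔-sym H↔) q , p)))
  where
  open Inverse using (to; from; strictlyInverseʳ)
  lb = covering⇒locallyBijective cov

  first : Vertex H → Vertex L
  first v = proj₁ (IsCovering.surjective cov v)

  f-first : ∀ v → f (first v) ≡ v
  f-first v = proj₂ (IsCovering.surjective cov v) refl

  second-exists : ∀ v → ∃[ y ] (f y ≡ v × y ≢ first v)
  -- The fibre can be searched, since `L` is finite and both equalities are decidable.
  second-exists v with any? (λ i → ↔⇒≟ H↔ (f (from L↔ i)) v ×-dec ¬? (↔⇒≟ L↔ (from L↔ i) (first v)))
  ... | yes (i , p) = from L↔ i , p
  ... | no none = contradiction (λ {x} {y} eq → subsingleton-walk lb (walk v (f y)) sub x y eq refl) ¬inj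
    where
    is-first : ∀ x → f x ≡ v → x ≡ first v
    is-first x fx≡v = decidable-stable (↔⇒≟ L↔ x (first v)) λ x≢ →
      none (to L↔ x , subst (λ z → f z ≡ v × z ≢ first v) (sym (strictlyInverseʳ L↔ x)) (fx≡v , x≢))

    sub : SubsingletonFibre lb v
    sub x y p q = trans (is-first x p) (sym (is-first y q))

  point : Fin 2 → Vertex H → Vertex L
  point 0F v = first v
  point 1F v = proj₁ (second-exists v)

  f-point : ∀ s v → f (point s v) ≡ v
  f-point 0F v = f-first v
  f-point 1F v = proj₁ (proj₂ (second-exists v))

  point-injective : ∀ {s t} v w → point s v ≡ point t w → s ≡ t × v ≡ w
  point-injective {s} {t} v w eq
    with refl ← trans (sym (f-point s v)) (trans (cong f eq) (f-point t w)) = sheet s t eq , refl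
    where
    sheet : ∀ s t → point s v ≡ point t v → s ≡ t
    sheet 0F 0F _ = refl
    sheet 0F 1F p = contradiction (sym p) (proj₂ (proj₂ (second-exists v)))
    sheet 1F 0F p = contradiction p (proj₂ (proj₂ (second-exists v)))
    sheet 1F 1F _ = refl

-- Pairs at distance one or two. A covering map separates them: identifying the first kind creates a
-- loop, identifying the second breaks local injectivity.
Near : (G : SimpleGraph) → Vertex G → Vertex G → Set
Near G u v = Adj G u v ⊎ (u ≢ v × ∃[ w ] (Adj G w u × Adj G w v))

near-separated : ∀ {G H f} → LocallyBijective G H f →
                 ∀ {u v} → Near G u v → f u ≢ f v
near-separated {H = H} lb (inj₁ a) eq = SimpleGraph.~-irrefl H eq (LocallyBijective.hom lb a)
near-separated lb (inj₂ (u≢v , _ , a , b)) eq = u≢v (LocallyBijective.separates lb a b eq)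

-- The lift at `x` of an edge from `f x` to `f y` ends over `f y`, hence at `y` by injectivity. This
-- is the part of `L ≅ H` that the bound needs.
near-reflected : ∀ {L H f} → LocallyBijective L H f → Injective _≡_ _≡_ f →
                 ∀ {x y} → Near H (f x) (f y) → Near L x y
near-reflected {L} {H} {f} lb inj {x} {y} = λ where
    (inj₁ a) → inj₁ (adj a)
    (inj₂ (x≢y , w , a , b)) →
      let x′ , x~x′ , fx′≡w = LocallyBijective.lifts lb (SimpleGraph.~-sym H a)
      in inj₂ ( x≢y ∘ cong f , x′ , SimpleGraph.~-sym L x~x′
              , adj (subst (λ z → Adj H z (f y)) (sym fx′≡w) b))
  where
  adj : ∀ {x y} → Adj H (f x) (f y) → Adj L x y
  adj a with x′ , x~x′ , eq ← LocallyBijective.lifts lb a = subst (Adj L _) (inj eq) x~x′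

-- Were `f` injective, the `n` pairwise near vertices would lift to pairwise near vertices of `L`.
-- The covering of `K` would separate them, but `K` has fewer than `n` vertices.
common-cover-noninjective :
  ∀ {L H K : SimpleGraph} {f : Vertex L → Vertex H} {m n} → m ℕ.< n →
  (q : Fin n → Vertex H) → (∀ {i j} → i < j → Near H (q i) (q j)) → HasOrder K m →
  L Covers K → IsCovering L H f → ¬ Injective _≡_ _≡_ f
common-cover-noninjective {L} {H} {f = f} m<n q near K↔ (g , g-cov) f-cov inj
  with i , j , i<j , eq ← pigeonhole m<n (Inverse.to K↔ ∘ g ∘ proj₁ ∘ IsCovering.surjective f-cov ∘ q) =
  near-separated (covering⇒locallyBijective g-cov)
    (near-reflected (covering⇒locallyBijective f-cov) inj
      (subst₂ (Near H) (section i) (section j) (near i<j)))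
    (Inverse-injective K↔ eq)
  where
  section : ∀ i → q i ≡ f (proj₁ (IsCovering.surjective f-cov (q i)))
  section i = sym (proj₂ (IsCovering.surjective f-cov (q i)) refl)

-- Properly 3-edge-coloured cubic graphs

Colour : Set
Colour = Fin 3

-- Each colour class is a perfect matching, encoded as a fixed-point-free involution. For a table of
-- values the axioms are then a finite check.
record EdgeColoured (V : Set) : Set where
  field
    act        : Colour → V → V
    involutive : ∀ c v → act c (act c v) ≡ v
    fixed-free : ∀ c v → act c v ≢ v
    proper     : ∀ c d v → act c v ≡ act d v → c ≡ d

  graph : SimpleGraph
  graph = record
    { Vertex   = V
    ; _~_      = λ u v → ∃[ c ] act c u ≡ v
    ; ~-sym    = λ { {u} (c , refl) → c , involutive c u }
    ; ~-irrefl = λ { {u} refl (c , eq) → fixed-free c u eq }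
    }

  -- Connectedness is certified by a single colour sequence whose trail meets every vertex.
  trail : V → List Colour → List V
  trail u []       = u ∷ []
  trail u (c ∷ cs) = u ∷ trail (act c u) cs

  trail-walk : ∀ {u v} cs → v ∈ trail u cs → Star (Adj graph) u v
  trail-walk []       (here refl) = ε
  trail-walk (c ∷ cs) (here refl) = ε
  trail-walk (c ∷ cs) (there i)   = (c , refl) ◅ trail-walk cs i

  connected-from : ∀ u → (∀ v → Star (Adj graph) u v) → Connected graph
  connected-from u walk =
    u , λ v w → reverse (SimpleGraph.~-sym graph) (walk v) ◅◅ walk w

open EdgeColoured using (act; graph)

module _ {V W : Set} (G : EdgeColoured V) (H : EdgeColoured W) (f : V → W) where

  equivariant⇒locallyBijective : (∀ c v → f (act G c v) ≡ act H c (f v)) →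
                                 LocallyBijective (graph G) (graph H) f
  equivariant⇒locallyBijective equi = record
    { hom       = λ { {u} (c , refl) → c , sym (equi c u) }
    ; separates = λ { {u} (c , refl) (d , refl) eq →
        cong (λ e → act G e u)
          (EdgeColoured.proper H c d (f u) (trans (sym (equi c u)) (trans eq (equi d u)))) }
    ; lifts     = λ { {u} (c , refl) → act G c u , (c , refl) , equi c u }
    }

  -- Colours may be permuted from vertex to vertex, since the maps onto `K₄` below do not preserve
  -- them.
  LocallyBijectiveAt : V → Set
  LocallyBijectiveAt v =
      (∀ c → ∃[ d ] act H d (f v) ≡ f (act G c v))
    × (∀ c d → f (act G c v) ≡ f (act G d v) → c ≡ d)
    × (∀ d → ∃[ c ] f (act G c v) ≡ act H d (f v))

  locallyBijectiveAt? : DecidableEquality W → ∀ v → Dec (LocallyBijectiveAt v)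
  locallyBijectiveAt? _≟W_ v =
          all? (λ c → any? λ d → act H d (f v) ≟W f (act G c v))
    ×-dec all? (λ c → all? λ d → (f (act G c v) ≟W f (act G d v)) →-dec (c ≟ d))
    ×-dec all? (λ d → any? λ c → f (act G c v) ≟W act H d (f v))

  locallyBijectiveAt⇒locallyBijective : (∀ v → LocallyBijectiveAt v) →
                                        LocallyBijective (graph G) (graph H) f
  locallyBijectiveAt⇒locallyBijective at = record
    { hom       = λ { {u} (c , refl) → proj₁ (at u) c }
    ; separates = λ { {u} (c , refl) (d , refl) eq →
        cong (λ e → act G e u) (proj₁ (proj₂ (at u)) c d eq) }
    ; lifts     = λ { {u} (d , refl) →
        let c , eq = proj₂ (proj₂ (at u)) d in act G c u , (c , refl) , eq }
    }

-- The 3-regular tree as the Cayley graph of ℤ/2 * ℤ/2 * ℤ/2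

-- Normal forms of group elements. As `reduced` is irrelevant, words with equal letters are equal
-- vertices.
record Word : Set where
  constructor word
  field
    letters  : List Colour
    .reduced : Linked _≢_ letters

open Word

word-≡ : ∀ {u v} → letters u ≡ letters v → u ≡ v
word-≡ {word _ _} {word _ _} refl = refl

-- Left multiplication by the generator `c`, with the one cancellation that can occur.
push : Colour → List Colour → List Colour
push c []      = c ∷ []
push c (d ∷ w) with c ≟ d
... | yes _ = w
... | no _  = c ∷ d ∷ w

push-reduced : ∀ c {w} → Linked _≢_ w → Linked _≢_ (push c w)
push-reduced c {[]}    r = [-]
push-reduced c {d ∷ w} r with c ≟ d
push-reduced c {d ∷ []}    r       | yes _ = []
push-reduced c {d ∷ e ∷ w} (_ ∷ r) | yes _ = r
... | no c≢d = c≢d ∷ r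

-- The two words differ by a leading `c` on the longer one. Later arguments use this symmetric form
-- instead of the comparison of letters.
push-cases : ∀ c w → push c w ≡ c ∷ w ⊎ w ≡ c ∷ push c w
push-cases c []      = inj₁ refl
push-cases c (d ∷ w) with c ≟ d
... | yes refl = inj₂ refl
... | no _     = inj₁ refl

push-∷ : ∀ c w → push c (c ∷ w) ≡ w
push-∷ c w with c ≟ c
... | yes _  = refl
... | no c≢c = contradiction refl c≢c

push-reduced-∷ : ∀ c w → .(Linked _≢_ (c ∷ w)) → push c w ≡ c ∷ w
push-reduced-∷ c []      r = refl
push-reduced-∷ c (d ∷ w) r with c ≟ d
... | yes refl = ⊥-elim-irr (head≢ r)
  where
  head≢ : ∀ {c w} → Linked _≢_ (c ∷ c ∷ w) → ⊥
  head≢ (c≢c ∷ _) = c≢c refl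
... | no _     = refl

∷-≢ : ∀ {A : Set} {x : A} {xs} → x ∷ xs ≢ xs
∷-≢ eq = ℕ.1+n≢n (cong length eq)

∷∷-≢ : ∀ {A : Set} {x y : A} {xs} → xs ≢ x ∷ y ∷ xs
∷∷-≢ eq = ℕ.m≢1+n+m _ {1} (cong length eq)

tree : EdgeColoured Word
tree = record
  { act        = λ { c (word w r) → word (push c w) (push-reduced c r) }
  ; involutive = λ { c (word w r) → word-≡ (involutive c w r) }
  ; fixed-free = λ c u eq → fixed-free c (letters u) (cong letters eq)
  ; proper     = λ c d u eq → proper c d (letters u) (cong letters eq)
  }
  where
  involutive : ∀ c w → .(Linked _≢_ w) → push c (push c w) ≡ w
  involutive c w r with push-cases c w
  ... | inj₁ eq = trans (cong (push c) eq) (push-∷ c w)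
  ... | inj₂ eq = trans (push-reduced-∷ c (push c w) (subst (Linked _≢_) eq r)) (sym eq)

  fixed-free : ∀ c w → push c w ≢ w
  fixed-free c w fix with push-cases c w
  ... | inj₁ eq = ∷-≢ (trans (sym eq) fix)
  ... | inj₂ eq = ∷-≢ (trans (sym eq) (sym fix))

  proper : ∀ c d w → push c w ≡ push d w → c ≡ d
  proper c d w same with push-cases c w | push-cases d w
  ... | inj₁ p | inj₁ q = ∷-injectiveˡ (trans (sym p) (trans same q))
  ... | inj₂ p | inj₂ q = ∷-injectiveˡ (trans (sym p) q)
  -- One letter lengthens `w` and the other shortens it, so equal results would give
  -- `w ≡ d ∷ c ∷ w`.
  ... | inj₁ p | inj₂ q = contradiction (trans q (cong (d ∷_) (trans (sym same) p))) ∷∷-≢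
  ... | inj₂ p | inj₁ q = contradiction (trans p (cong (c ∷_) (trans same q))) ∷∷-≢

root : Word
root = word [] []

tree-connected : Connected (graph tree)
tree-connected = EdgeColoured.connected-from tree root
  λ { (word w r) → reverse (SimpleGraph.~-sym (graph tree)) (descend w r) }
  where
  descend : ∀ w .(r : Linked _≢_ w) → Star (Adj (graph tree)) (word w r) root
  descend []      r = ε
  descend (c ∷ w) r = (c , word-≡ (push-∷ c w)) ◅ descend w (Linked.tail r)

-- Acyclicity and universality of the tree

record Up (u v : Word) : Set where
  constructor up-by
  field
    colour    : Colour
    letters-≡ : letters v ≡ colour ∷ letters u

adj⇒up⊎down : ∀ {u v} → Adj (graph tree) u v → Up u v ⊎ Up v u
adj⇒up⊎down {u} (c , refl) with push-cases c (letters u)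
... | inj₁ eq = inj₁ (up-by c eq)
... | inj₂ eq = inj₂ (up-by c eq)

-- The parent is the word without its first letter. Hence a path that goes up cannot come down
-- without returning to the vertex it left.
up-injective : ∀ {u v w} → Up u w → Up v w → u ≡ v
up-injective (up-by _ p) (up-by _ q) = word-≡ (∷-injectiveʳ (trans (sym p) q))

depth : Word → ℕ
depth = length ∘ letters

up-depth : ∀ {u v} → Up u v → depth v ≡ suc (depth u)
up-depth (up-by _ eq) = cong length eq

Path : ∀ n → (Fin (suc n) → Word) → Set
Path n p = Injective _≡_ _≡_ p × (∀ i → Adj (graph tree) (p (inject₁ i)) (p (suc i)))

tail-path : ∀ {n p} → Path (suc n) p → Path n (p ∘ suc)
tail-path (inj , step) = (λ eq → suc-injective (inj eq)) , step ∘ suc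

-- A path in the tree that has gone up keeps going up, since the only way down
-- leads back to the previous vertex.
path-up : ∀ n {p} → Path (suc n) p → Up (p 0F) (p 1F) →
          Up (p (inject₁ (fromℕ n))) (p (fromℕ (suc n)))
          × depth (p 0F) ℕ.< depth (p (fromℕ (suc n)))
path-up zero    path up = up , ℕ.≤-reflexive (sym (up-depth up))
path-up (suc n) path@(inj , step) up with adj⇒up⊎down (step 1F)
... | inj₂ down = contradiction (inj (up-injective up down)) λ ()
... | inj₁ up′  =
  let last , lt = path-up n (tail-path path) up′
  in last , ℕ.<-trans (ℕ.≤-reflexive (sym (up-depth up))) lt

-- Mirror image of `path-up`, propagated from the last step backwards: a step up before a step down
-- would repeat a vertex.
path-down : ∀ n {p} → Path (suc n) p → Up (p (fromℕ (suc n))) (p (inject₁ (fromℕ n))) →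
            Up (p 1F) (p 0F) × depth (p (fromℕ (suc n))) ℕ.< depth (p 0F)
path-down zero    path down = down , ℕ.≤-reflexive (sym (up-depth down))
path-down (suc n) path@(inj , step) down
  with first , lt ← path-down n (tail-path path) down
  with adj⇒up⊎down (step 0F)
... | inj₁ up    = contradiction (inj (up-injective up first)) λ ()
... | inj₂ first′ = first′ , ℕ.<-trans lt (ℕ.≤-reflexive (sym (up-depth first′)))

-- If the closing edge goes up, uniqueness of parents forbids a first step down. The path then
-- climbs and ends deeper than it starts, against the closing edge. If it goes down, the same
-- argument runs backwards from the last step.
tree-acyclic : ¬ Cycle (graph tree)
tree-acyclic record { k = k ; vertexAt = p ; distinct = inj ; step = step ; close = close }
  with adj⇒up⊎down close
... | inj₁ close-up with adj⇒up⊎down (step 0F)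
...   | inj₁ up   = ℕ.<-asym (ℕ.≤-reflexive (sym (up-depth close-up)))
                             (proj₂ (path-up (suc k) (inj , step) up))
...   | inj₂ down = contradiction (inj (up-injective down close-up)) λ ()
tree-acyclic record { k = k ; vertexAt = p ; distinct = inj ; step = step ; close = close }
  | inj₂ close-down with adj⇒up⊎down (step (fromℕ (suc k)))
...   | inj₁ up   = contradiction (inj (up-injective up close-down)) λ ()
...   | inj₂ down = ℕ.<-asym (ℕ.≤-reflexive (sym (up-depth close-down)))
                             (proj₂ (path-down (suc k) (inj , step) down))

-- Words act on a base point, and this orbit map commutes with each colour because cancellation
-- matches involutivity.
tree-universal : ∀ {V} (H : EdgeColoured V) → Connected (graph H) →
                 IsUniversalCover (graph H) (graph tree)
tree-universal H conn@(v₀ , _) =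
  (tree-connected , tree-acyclic) ,
  (unfold , locallyBijective⇒covering
              (equivariant⇒locallyBijective tree H unfold (λ c u → equivariant c (letters u)))
              root conn)
  where
  unfold : Word → _
  unfold u = foldr (act H) v₀ (letters u)

  equivariant : ∀ c w → foldr (act H) v₀ (push c w) ≡ act H c (foldr (act H) v₀ w)
  equivariant c w with push-cases c w
  ... | inj₁ eq = cong (foldr (act H) v₀) eq
  ... | inj₂ eq = sym (trans (cong (act H c ∘ foldr (act H) v₀) eq)
                             (EdgeColoured.involutive H c (foldr (act H) v₀ (push c w))))

-- Double covers

swap-if : Bool → Fin 2 → Fin 2
swap-if b s = if b then opposite s else s

swap-if-involutive : ∀ b s → swap-if b (swap-if b s) ≡ s
swap-if-involutive true  = opposite-involutive
swap-if-involutive false = λ _ → refl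

-- A voltage assignment in ℤ/2: crossing edges exchange the two sheets, and `crosses-sym` makes both
-- ends of an edge agree.
module _ {V : Set} (H : EdgeColoured V) (crosses : Colour → V → Bool)
         (crosses-sym : ∀ c v → crosses c (act H c v) ≡ crosses c v) where

  doubleCover : EdgeColoured (V × Fin 2)
  doubleCover = record
    { act        = λ { c (v , s) → act H c v , swap-if (crosses c v) s }
    ; involutive = λ { c (v , s) → cong₂ _,_ (EdgeColoured.involutive H c v)
        (trans (cong (λ b → swap-if b (swap-if (crosses c v) s)) (crosses-sym c v))
               (swap-if-involutive (crosses c v) s)) }
    ; fixed-free = λ { c (v , s) eq → EdgeColoured.fixed-free H c v (cong proj₁ eq) }
    ; proper     = λ { c d (v , s) eq → EdgeColoured.proper H c d v (cong proj₁ eq) }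
    }

  doubleCover-covers : Connected (graph H) → graph doubleCover Covers graph H
  doubleCover-covers conn@(v₀ , _) = proj₁ ,
    locallyBijective⇒covering
      (equivariant⇒locallyBijective doubleCover H proj₁ (λ { c (v , s) → refl }))
      (v₀ , 0F) conn

-- The base graphs

table : ∀ {A : Set} {m n} → Vec (Vec A n) m → Fin m → Fin n → A
table t i j = lookup (lookup t i) j

edgeColoured? : ∀ {n} (a : Colour → Fin n → Fin n) →
  Dec ((∀ c v → a c (a c v) ≡ v) × (∀ c v → a c v ≢ v) × (∀ c d v → a c v ≡ a d v → c ≡ d))
edgeColoured? a =
        all? (λ c → all? λ v → a c (a c v) ≟ v)
  ×-dec all? (λ c → all? λ v → ¬? (a c v ≟ v))
  ×-dec all? (λ c → all? λ d → all? λ v → (a c v ≟ a d v) →-dec (c ≟ d))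

-- Two triangles 046 and 123 joined by the edge 24, and an edge 57 with 5 joined to 0 and 3, and 7
-- joined to 6 and 1.
act₁ : Colour → Fin 8 → Fin 8
act₁ = table
  ( (5F ∷ 7F ∷ 3F ∷ 2F ∷ 6F ∷ 0F ∷ 4F ∷ 1F ∷ [])
  ∷ (6F ∷ 3F ∷ 4F ∷ 1F ∷ 2F ∷ 7F ∷ 0F ∷ 5F ∷ [])
  ∷ (4F ∷ 2F ∷ 1F ∷ 5F ∷ 0F ∷ 3F ∷ 7F ∷ 6F ∷ [])
  ∷ [])

H₁ : EdgeColoured (Fin 8)
H₁ = let i , f , p = from-yes (edgeColoured? act₁)
     in record { act = act₁ ; involutive = i ; fixed-free = f ; proper = p }

-- The three perfect matchings of `K₄`.
act₂ : Colour → Fin 4 → Fin 4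
act₂ = table
  ( (1F ∷ 0F ∷ 3F ∷ 2F ∷ [])
  ∷ (2F ∷ 3F ∷ 0F ∷ 1F ∷ [])
  ∷ (3F ∷ 2F ∷ 1F ∷ 0F ∷ [])
  ∷ [])

H₂ : EdgeColoured (Fin 4)
H₂ = let i , f , p = from-yes (edgeColoured? act₂)
     in record { act = act₂ ; involutive = i ; fixed-free = f ; proper = p }

H₁-connected : Connected (graph H₁)
H₁-connected = EdgeColoured.connected-from H₁ 0F λ v → EdgeColoured.trail-walk H₁ colours
  (from-yes (all? λ v → Any.any? (v ≟_) (EdgeColoured.trail H₁ 0F colours)) v)
  where
  -- A Hamiltonian path alternating between two colours.
  colours = 0F ∷ 1F ∷ 0F ∷ 1F ∷ 0F ∷ 1F ∷ 0F ∷ []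

H₂-connected : Connected (graph H₂)
H₂-connected = EdgeColoured.connected-from H₂ 0F λ v → EdgeColoured.trail-walk H₂ colours
  (from-yes (all? λ v → Any.any? (v ≟_) (EdgeColoured.trail H₂ 0F colours)) v)
  where
  colours = 0F ∷ 1F ∷ 0F ∷ []

-- The triangle 046 with the adjacent vertices 5 and 7 attached to 0 and 6: one vertex more than
-- `K₄` has.
cluster : Fin 5 → Fin 8
cluster = lookup (0F ∷ 4F ∷ 5F ∷ 6F ∷ 7F ∷ [])

cluster-near : ∀ {i j} → i < j → Near (graph H₁) (cluster i) (cluster j)
cluster-near {i} {j} i<j =
  from-yes (all? λ i → all? λ j → ¬? (i ≟ j) →-dec near? (cluster i) (cluster j)) i j (<⇒≢ i<j)
  where
  adj? : ∀ u v → Dec (Adj (graph H₁) u v)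
  adj? u v = any? λ c → act₁ c u ≟ v

  near? : ∀ u v → Dec (Near (graph H₁) u v)
  near? u v = adj? u v ⊎-dec (¬? (u ≟ v) ×-dec any? λ w → adj? w u ×-dec adj? w v)

common-cover-order : ∀ L m → Connected L → CommonCover (graph H₁) (graph H₂) L →
                     HasOrder L m → 16 ≤ m
common-cover-order L m _ ((f , f-cov) , g) L↔ =
  noninjective-covering-order f-cov H₁-connected L↔ (↔-id _)
    (common-cover-noninjective (ℕ.n<1+n 4) cluster cluster-near (↔-id _) g f-cov)

-- The two minimal common covers

crossesSym? : (crosses : Colour → Fin 8 → Bool) →
              Dec (∀ c v → crosses c (act₁ c v) ≡ crosses c v)
crossesSym? crosses = all? λ c → all? λ v → crosses c (act₁ c v) Bool.≟ crosses c v

module _ (K : EdgeColoured (Fin 8 × Fin 2)) where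

  visited? : ∀ cs → Dec (∀ v s → (v , s) ∈ EdgeColoured.trail K (0F , 0F) cs)
  visited? cs = all? λ v → all? λ s →
    Any.any? (≡-dec _≟_ _≟_ (v , s)) (EdgeColoured.trail K (0F , 0F) cs)

  covers-H₂? : ∀ f → Dec (∀ v s → LocallyBijectiveAt K H₂ f (v , s))
  covers-H₂? f = all? λ v → all? λ s → locallyBijectiveAt? K H₂ f _≟_ (v , s)

  minimal : graph K Covers graph H₁ →
            ∀ cs → (∀ v s → (v , s) ∈ EdgeColoured.trail K (0F , 0F) cs) →
            ∀ f → (∀ v s → LocallyBijectiveAt K H₂ f (v , s)) →
            IsMinimalCommonCover (graph H₁) (graph H₂) (graph K)
  minimal covers-H₁ cs visited f covers-H₂ =
      EdgeColoured.connected-from K (0F , 0F)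
        (λ { (v , s) → EdgeColoured.trail-walk K cs (visited v s) })
    , ( covers-H₁
      , f
      , locallyBijective⇒covering
          (locallyBijectiveAt⇒locallyBijective K H₂ f λ { (v , s) → covers-H₂ v s })
          (0F , 0F) H₂-connected )
    , 16 , ↔-sym *↔× , common-cover-order

-- The crossing edges 24 and 57 lie on no triangle of H₁.
crosses₁ : Colour → Fin 8 → Bool
crosses₁ 1F 2F = true
crosses₁ 1F 4F = true
crosses₁ 1F 5F = true
crosses₁ 1F 7F = true
crosses₁ _  _  = false

K₁ : EdgeColoured (Fin 8 × Fin 2)
K₁ = doubleCover H₁ crosses₁ (from-yes (crossesSym? crosses₁))

K₁-minimal : IsMinimalCommonCover (graph H₁) (graph H₂) (graph K₁)
K₁-minimal = minimal K₁
  (doubleCover-covers H₁ crosses₁ (from-yes (crossesSym? crosses₁)) H₁-connected)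
  colours (from-yes (visited? K₁ colours))
  f (from-yes (covers-H₂? K₁ f))
  where
  -- A Hamiltonian path: 15 steps for 16 vertices.
  colours : List Colour
  colours = 0F ∷ 1F ∷ 0F ∷ 1F ∷ 0F ∷ 1F ∷ 0F ∷ 2F ∷ 0F ∷ 1F ∷ 0F ∷ 1F ∷ 0F ∷ 1F ∷ 0F ∷ []

  -- Every vertex must see the three values other than its own. With 0 on 0, 1 and 3 on 3, 6, the
  -- vertices 2, 4, 5, 7 take values 1 and 2, and on `H₁` all six pairs of them would have to
  -- differ. Exchanging 1 and 2 between the sheets, the crossings turn the conditions for 24 and 57
  -- into equalities, solved by the classes 24 and 57.
  f : Fin 8 × Fin 2 → Fin 4
  f (v , s) = table
    ( (0F ∷ 0F ∷ []) ∷ (0F ∷ 0F ∷ []) ∷ (1F ∷ 2F ∷ []) ∷ (3F ∷ 3F ∷ [])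
    ∷ (1F ∷ 2F ∷ []) ∷ (2F ∷ 1F ∷ []) ∷ (3F ∷ 3F ∷ []) ∷ (2F ∷ 1F ∷ [])
    ∷ []) v s

-- The crossing edges 23 and 46 lie on the triangles 123 and 046 of H₁.
crosses₂ : Colour → Fin 8 → Bool
crosses₂ 0F 2F = true
crosses₂ 0F 3F = true
crosses₂ 0F 4F = true
crosses₂ 0F 6F = true
crosses₂ _  _  = false

K₂ : EdgeColoured (Fin 8 × Fin 2)
K₂ = doubleCover H₁ crosses₂ (from-yes (crossesSym? crosses₂))

K₂-minimal : IsMinimalCommonCover (graph H₁) (graph H₂) (graph K₂)
K₂-minimal = minimal K₂
  (doubleCover-covers H₁ crosses₂ (from-yes (crossesSym? crosses₂)) H₁-connected)
  colours (from-yes (visited? K₂ colours))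
  f (from-yes (covers-H₂? K₂ f))
  where
  colours : List Colour
  colours = 0F ∷ 1F ∷ 0F ∷ 1F ∷ 0F ∷ 2F ∷ 0F ∷ 1F ∷ 2F ∷ 0F ∷ 1F ∷ 0F ∷ 1F ∷ 2F ∷ 0F ∷ []

  -- As for `K₁`, but crossing 23 and 46 relaxes the conditions for 25, seen from 3, and 47, seen
  -- from 6. The classes are now 25 and 47.
  f : Fin 8 × Fin 2 → Fin 4
  f (v , s) = table
    ( (0F ∷ 0F ∷ []) ∷ (0F ∷ 0F ∷ []) ∷ (2F ∷ 1F ∷ []) ∷ (3F ∷ 3F ∷ [])
    ∷ (1F ∷ 2F ∷ []) ∷ (2F ∷ 1F ∷ []) ∷ (3F ∷ 3F ∷ []) ∷ (1F ∷ 2F ∷ [])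
    ∷ []) v s

-- Triangles as an isomorphism invariant

HasTriangle : SimpleGraph → Set
HasTriangle G = ∃[ u ] ∃[ v ] ∃[ w ] (Adj G u v × Adj G v w × Adj G w u)

isomorphic-hasTriangle : ∀ {G H} → Isomorphic G H → HasTriangle G → HasTriangle H
isomorphic-hasTriangle (_ , adj) (u , v , w , a , b , c) =
  _ , _ , _ , to (adj u v) a , to (adj v w) b , to (adj w u) c
  where open Equivalence using (to)

K₁-hasTriangle : HasTriangle (graph K₁)
K₁-hasTriangle = (1F , 0F) , (2F , 0F) , (3F , 0F) , (2F , refl) , (0F , refl) , (1F , refl)

K₂-triangle-free : ¬ HasTriangle (graph K₂)
K₂-triangle-free ((u , s) , _ , _ , (a , refl) , (b , refl) , (c , closed)) =
  -- A finite check. It succeeds because each triangle of `H₁` has exactly one crossing edge, so its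
  -- lifts end on the other sheet.
  from-yes (all? λ u → all? λ s → all? λ a → all? λ b → all? λ c →
    ¬? (≡-dec _≟_ _≟_ (act K₂ c (act K₂ b (act K₂ a (u , s)))) (u , s))) u s a b c closed

mainTheorem6 : ∃[ H₁ ] ∃[ H₂ ]
    ( Finite H₁ × Connected H₁
    × Finite H₂ × Connected H₂
    × HaveCommonUniversalCover H₁ H₂
    × ∃[ K₁ ] ∃[ K₂ ]
    ( IsMinimalCommonCover H₁ H₂ K₁
    × IsMinimalCommonCover H₁ H₂ K₂
    × ¬ Isomorphic K₁ K₂ ) )
mainTheorem6 =
    graph H₁ , graph H₂
  , (8 , ↔-id _) , H₁-connected
  , (4 , ↔-id _) , H₂-connected
  , (graph tree , tree-universal H₁ H₁-connected , tree-universal H₂ H₂-connected)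
  , graph K₁ , graph K₂
  , K₁-minimal , K₂-minimal
  , λ iso → K₂-triangle-free (isomorphic-hasTriangle {graph K₁} {graph K₂} iso K₁-hasTriangle)
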